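{- Let $G$ be a graph with a spanning subgraph $F$ and a spanning tree $T$. Let $M$ be a matching of $F$ which contains exactly one edge of each non-trivial component of $F$, where each edge of $M$ is incident to a vertex that is not a cut vertex of $F$. Then $G$ has a connected spanning subgraph $H$ containing $E(F)\setminus M$ such that for each vertex $v$, $$d_F(v)\le d_H(v)\le d_T(v)+\max\{0,d_F(v)-1\}.$$
   Context: All graphs are finite, without loops, multiple edges allowed. A component is non-trivial if it has at least one edge (more than one vertex). -}

module Defs where

open import Data.Nat using (ℕ; _+_; _∸_; _≤_)
open import Data.Fin using (Fin; _≟_)
open import Data.Fin.Properties using () 
open import Data.Bool using (Bool; true; false; _∧_; _∨_; not; if_then_else_)
open import Data.List using (List; map; allFin)
open import Data.Nat.ListAction using (sum)
open import Data.Product using (_×_; _,_; proj₁; proj₂; ∃; ∃-syntax; Σ-syntax)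
open import Data.Sum using (_⊎_)
open import Data.Unit using (⊤)
open import Relation.Nullary using (¬_)
open import Relation.Nullary.Decidable using (⌊_⌋)
open import Relation.Binary.PropositionalEquality using (_≡_; _≢_)

-- A finite loopless multigraph G on vertex set Fin n with edge set Fin m;
-- edge e has endpoints  ends e.  Multiple edges are allowed.
Ends : ℕ → ℕ → Set
Ends n m = Fin m → Fin n × Fin n

Loopless : ∀ {n m} → Ends n m → Set
Loopless ends = ∀ e → proj₁ (ends e) ≢ proj₂ (ends e)

-- A spanning subgraph of G is given by its edge set, a predicate on Fin m.
EdgeSet : ℕ → Set
EdgeSet m = Fin m → Bool

_∈E_ : ∀ {m} → Fin m → EdgeSet m → Set
e ∈E S = S e ≡ true

_⊆E_ : ∀ {m} → EdgeSet m → EdgeSet m → Set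
S ⊆E S' = ∀ e → e ∈E S → e ∈E S'

delete : ∀ {m} → EdgeSet m → Fin m → EdgeSet m
delete S e f = S f ∧ not ⌊ f ≟ e ⌋

Joins : ∀ {n m} → Ends n m → Fin m → Fin n → Fin n → Set
Joins ends e x y = (ends e ≡ (x , y)) ⊎ (ends e ≡ (y , x))

-- Walks in the subgraph with edge set S using only vertices satisfying P
-- (the start vertex is assumed allowed by the caller).
data WalkIn {n m} (ends : Ends n m) (S : EdgeSet m) (P : Fin n → Set)
            (u : Fin n) : Fin n → Set where
  here : WalkIn ends S P u u
  step : ∀ {x y} e → WalkIn ends S P u x → e ∈E S → Joins ends e x y → P y →
         WalkIn ends S P u y

Reach : ∀ {n m} → Ends n m → EdgeSet m → Fin n → Fin n → Set
Reach ends S u w = WalkIn ends S (λ _ → ⊤) u w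

ReachAvoiding : ∀ {n m} → Ends n m → EdgeSet m → Fin n → Fin n → Fin n → Set
ReachAvoiding ends S v u w = WalkIn ends S (λ x → x ≢ v) u w

Connected : ∀ {n m} → Ends n m → EdgeSet m → Set
Connected ends S = ∀ u w → Reach ends S u w

-- acyclic: no edge lies on a cycle, i.e. for no edge e of S are its
-- endpoints still connected in S - e
Acyclic : ∀ {n m} → Ends n m → EdgeSet m → Set
Acyclic ends S = ∀ e → e ∈E S →
  ¬ Reach ends (delete S e) (proj₁ (ends e)) (proj₂ (ends e))

IsSpanningTree : ∀ {n m} → Ends n m → EdgeSet m → Set
IsSpanningTree ends T = Connected ends T × Acyclic ends T

CutVertex : ∀ {n m} → Ends n m → EdgeSet m → Fin n → Set
CutVertex ends S v = ∃[ u ] ∃[ w ] (u ≢ v × w ≢ v × Reach ends S u w ×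
                                    ¬ ReachAvoiding ends S v u w)

Incident : ∀ {n m} → Ends n m → Fin n → Fin m → Set
Incident ends v e = (proj₁ (ends e) ≡ v) ⊎ (proj₂ (ends e) ≡ v)

incident? : ∀ {n m} → Ends n m → Fin n → Fin m → Bool
incident? ends v e = ⌊ proj₁ (ends e) ≟ v ⌋ ∨ ⌊ proj₂ (ends e) ≟ v ⌋

-- degree of v in the spanning subgraph S (no loops, so each incident edge counts once)
degree : ∀ {n m} → Ends n m → EdgeSet m → Fin n → ℕ
degree {m = m} ends S v =
  sum (map (λ e → if S e ∧ incident? ends v e then 1 else 0) (allFin m))

IsMatching : ∀ {n m} → Ends n m → EdgeSet m → Set
IsMatching ends M = ∀ e f v → e ∈E M → f ∈E M →
  Incident ends v e → Incident ends v f → e ≡ f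

SameComponent : ∀ {n m} → Ends n m → EdgeSet m → Fin m → Fin m → Set
SameComponent ends S e f = Reach ends S (proj₁ (ends e)) (proj₁ (ends f))

OneEdgePerComponent : ∀ {n m} → Ends n m → EdgeSet m → EdgeSet m → Set
OneEdgePerComponent ends F M =
  (M ⊆E F) ×
  (∀ e → e ∈E F → ∃[ f ] (f ∈E M × SameComponent ends F e f)) ×
  (∀ e f f' → e ∈E F → f ∈E M → f' ∈E M →
     SameComponent ends F e f → SameComponent ends F e f' → f ≡ f')

_∖E_ : ∀ {m} → EdgeSet m → EdgeSet m → EdgeSet m
(F ∖E M) e = F e ∧ not (M e)

-- F ∖ M has, in each non-trivial component C of F with M-edge xy, all of C or all of C except
-- a leaf x in one piece. Treat the components one at a time: in T with the earlier components
-- contracted, take a breadth-first tree rooted in C and let every other vertex of C give up its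
-- parent edge. Each of them loses its own edge, and contracting C restores connectedness. The
-- bounds then hold except at ends of M-edges, and only if such an end has lost all its T-edges.
-- In that case the M-edge is added to H, and its other end must be made to lose an edge too:
-- either it already has, or a redundant edge was put in reserve for this purpose, or it is a
-- leaf of F and the last edge of a path of H leading to it has become redundant. This may
-- create a new deficiency, but the number of M-edges in H has grown.
module Submission where

open import Defs
open import Data.Bool using (true; false; if_then_else_; _∧_; _∨_; not)
import Data.Bool.Properties as Bool
open import Data.Empty using (⊥)
open import Data.Fin using (Fin; zero; suc; _≟_)
open import Data.Fin.Properties using (any?)
open import Data.List using (List; []; _∷_; allFin; tabulate)
open import Data.List.Membership.DecPropositional using (_∈?_)
open import Data.List.Membership.Propositional using (_∈_; _∉_)
open import Data.List.Membership.Propositional.Properties using (∈-allFin)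
open import Data.List.Properties using (map-tabulate)
open import Data.List.Relation.Unary.Any using (here; there)
open import Data.Maybe using (Maybe; just; nothing)
import Data.Maybe.Properties as Maybe
open import Data.Nat using (ℕ; zero; suc; _+_; _∸_; _≤_; _<_; z≤n; s≤s)
open import Data.Nat.Induction using (<-wellFounded)
open import Data.Nat.ListAction using (sum)
open import Data.Nat.Properties
  using (≤-refl; ≤-reflexive; ≤-trans; <-trans; <-irrefl; ≰⇒>; +-mono-≤; +-mono-<-≤; +-mono-≤-<;
         +-comm; +-suc; m≤m+n; m≤n+m; ∸-monoˡ-≤; +-∸-assoc; module ≤-Reasoning)
open import Data.Nat.Solver using (module +-*-Solver)
open import Data.Product using (_×_; _,_; proj₁; proj₂; ∃; ∃-syntax)
import Data.Product.Properties as Product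
open import Data.Sum using (_⊎_; inj₁; inj₂; [_,_]′)
open import Data.Unit using (tt)
open import Function using (id; _∘_)
open import Induction.WellFounded using (Acc; acc)
open import Relation.Binary.Construct.Closure.ReflexiveTransitive as Star
  using (Star; ε; _◅_; _◅◅_; _⋆)
open import Relation.Binary.PropositionalEquality
  using (_≡_; _≢_; refl; sym; trans; cong; cong₂; subst; subst₂)
open import Relation.Nullary using (¬_; Dec; yes; no; contradiction)
open import Relation.Nullary.Decidable using (¬?; _×-dec_; _⊎-dec_; ⌊_⌋; decidable-stable)
open import Relation.Unary using (Decidable)

-- Edge sets

_∈E?_ : ∀ {m} (e : Fin m) (S : EdgeSet m) → Dec (e ∈E S)
e ∈E? S = S e Bool.≟ true

module _ {m} (S R : EdgeSet m) {e : Fin m} where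

  ∖E⁺ : e ∈E S → ¬ e ∈E R → e ∈E (S ∖E R)
  ∖E⁺ e∈S e∉R with S e | R e
  ... | true | false = refl
  ... | true | true  = contradiction refl e∉R

  ∖E⁻ : e ∈E (S ∖E R) → e ∈E S × ¬ e ∈E R
  ∖E⁻ e∈ with S e | R e
  ... | true | false = refl , λ ()

module _ {m} (S : EdgeSet m) {e f : Fin m} where

  delete⁺ : f ∈E S → f ≢ e → f ∈E delete S e
  delete⁺ f∈S f≢e with S f | f ≟ e
  ... | true | no _    = refl
  ... | true | yes f≡e = contradiction f≡e f≢e

  delete⁻ : f ∈E delete S e → f ∈E S × f ≢ e
  delete⁻ f∈ with S f | f ≟ e
  ... | true | no f≢e = refl , f≢e

-- Sums over edges

∑ : ∀ {m} → (Fin m → ℕ) → ℕ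
∑ f = sum (tabulate f)

module _ where
  open +-*-Solver

  interchange : ∀ a b c d → (a + b) + (c + d) ≡ (a + c) + (b + d)
  interchange = solve 4 (λ a b c d → (a :+ b) :+ (c :+ d) := (a :+ c) :+ (b :+ d)) refl

∑-+ : ∀ {m} (f g : Fin m → ℕ) → ∑ (λ i → f i + g i) ≡ ∑ f + ∑ g
∑-+ {zero}  f g = refl
∑-+ {suc m} f g =
  trans (cong (f zero + g zero +_) (∑-+ (f ∘ suc) (g ∘ suc)))
        (interchange (f zero) (g zero) _ _)

∑-mono : ∀ {m} {f g : Fin m → ℕ} → (∀ i → f i ≤ g i) → ∑ f ≤ ∑ g
∑-mono {zero}  f≤g = z≤n
∑-mono {suc m} f≤g = +-mono-≤ (f≤g zero) (∑-mono (f≤g ∘ suc))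

∑-mono-< : ∀ {m} {f g : Fin m → ℕ} → (∀ i → f i ≤ g i) → ∀ j → f j < g j → ∑ f < ∑ g
∑-mono-< {suc m} f≤g zero    f<g = +-mono-<-≤ f<g (∑-mono (f≤g ∘ suc))
∑-mono-< {suc m} f≤g (suc j) f<g = +-mono-≤-< (f≤g zero) (∑-mono-< (f≤g ∘ suc) j f<g)

-- Serves to compare degrees in `F` and in `F` without `M`: at a vertex they differ by at most one
-- edge.
∑-mono-suc : ∀ {m} {f g : Fin m → ℕ} j → (∀ i → i ≢ j → f i ≤ g i) → f j ≤ suc (g j) →
             ∑ f ≤ suc (∑ g)
∑-mono-suc {suc m} zero f≤g f≤1+g =
  +-mono-≤ f≤1+g (∑-mono (λ i → f≤g (suc i) λ ()))
∑-mono-suc {suc m} {f} {g} (suc j) f≤g f≤1+g =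
  ≤-trans (+-mono-≤ (f≤g zero λ ())
                    (∑-mono-suc j (λ i i≢j → f≤g (suc i) λ { refl → i≢j refl }) f≤1+g))
          (≤-reflexive (+-suc (g zero) _))

size : ∀ {m} → EdgeSet m → ℕ
size S = ∑ (λ e → if S e then 1 else 0)

delete-size : ∀ {m} (S : EdgeSet m) {e} → e ∈E S → size (delete S e) < size S
delete-size S {e} e∈S = ∑-mono-< shrinks e (drops e∈S)
  where
  shrinks : ∀ f → (if delete S e f then 1 else 0) ≤ (if S f then 1 else 0)
  shrinks f with S f | f ≟ e
  ... | false | _     = z≤n
  ... | true  | no _  = ≤-refl
  ... | true  | yes _ = z≤n
  drops : e ∈E S → (if delete S e e then 1 else 0) < (if S e then 1 else 0)
  drops e∈S with S e | e ≟ e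
  ... | true | yes _  = s≤s z≤n
  ... | true | no e≢e = contradiction refl e≢e

-- Incidence, adjacency and walks in a multigraph.

module Graph {n m} (ends : Ends n m) where

  src : Fin m → Fin n
  src e = proj₁ (ends e)

  incident-dec : ∀ v e → Dec (Incident ends v e)
  incident-dec v e = (proj₁ (ends e) ≟ v) ⊎-dec (proj₂ (ends e) ≟ v)

  joins-dec : ∀ e x y → Dec (Joins ends e x y)
  joins-dec e x y = (ends e ≟² (x , y)) ⊎-dec (ends e ≟² (y , x))
    where _≟²_ = Product.≡-dec _≟_ _≟_

  joins-sym : ∀ {e x y} → Joins ends e x y → Joins ends e y x
  joins-sym (inj₁ eq) = inj₂ eq
  joins-sym (inj₂ eq) = inj₁ eq

  joins-ends : ∀ e → Joins ends e (src e) (proj₂ (ends e))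
  joins-ends e = inj₁ refl

  joins⇒incidentˡ : ∀ {e x y} → Joins ends e x y → Incident ends x e
  joins⇒incidentˡ (inj₁ eq) = inj₁ (cong proj₁ eq)
  joins⇒incidentˡ (inj₂ eq) = inj₂ (cong proj₂ eq)

  joins⇒incidentʳ : ∀ {e x y} → Joins ends e x y → Incident ends y e
  joins⇒incidentʳ = joins⇒incidentˡ ∘ joins-sym

  incident⇒joins : ∀ {e v} → Incident ends v e → ∃[ w ] Joins ends e v w
  incident⇒joins (inj₁ refl) = _ , inj₁ refl
  incident⇒joins (inj₂ refl) = _ , inj₂ refl

  joins-unique : ∀ {e a b x y} → Joins ends e a b → Joins ends e x y →
                 (x ≡ a × y ≡ b) ⊎ (x ≡ b × y ≡ a)
  joins-unique (inj₁ p) (inj₁ q) with refl ← trans (sym p) q = inj₁ (refl , refl)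
  joins-unique (inj₁ p) (inj₂ q) with refl ← trans (sym p) q = inj₂ (refl , refl)
  joins-unique (inj₂ p) (inj₁ q) with refl ← trans (sym p) q = inj₂ (refl , refl)
  joins-unique (inj₂ p) (inj₂ q) with refl ← trans (sym p) q = inj₁ (refl , refl)

  incident-joins : ∀ {e v x y} → Incident ends v e → Joins ends e x y → v ≡ x ⊎ v ≡ y
  incident-joins i j with joins-unique j (proj₂ (incident⇒joins i))
  ... | inj₁ (p , _) = inj₁ p
  ... | inj₂ (p , _) = inj₂ p

  Adj : (Fin m → Set) → Fin n → Fin n → Set
  Adj P x y = ∃[ e ] P e × Joins ends e x y

  -- Walks over an arbitrary edge predicate, since the connecting edge sets below mix labels with
  -- membership. As a `Star` they can be joined, reversed and mapped.
  Linked : (Fin m → Set) → Fin n → Fin n → Set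
  Linked P = Star (Adj P)

  module _ {P : Fin m → Set} where

    link : ∀ {e x y} → P e → Joins ends e x y → Linked P x y
    link p j = (_ , p , j) ◅ ε

    linked-sym : ∀ {x y} → Linked P x y → Linked P y x
    linked-sym = Star.reverse (λ { (e , p , j) → e , p , joins-sym j })

    linked-map : ∀ {Q : Fin m → Set} → (∀ e → P e → Q e) → ∀ {x y} → Linked P x y → Linked Q x y
    linked-map P⇒Q = Star.map (λ { (e , p , j) → e , P⇒Q e p , j })

    first-edge : ∀ {x y} → x ≢ y → Linked P x y → ∃[ e ] P e × Incident ends x e
    first-edge x≢y ε                 = contradiction refl x≢y
    first-edge x≢y ((e , p , j) ◅ _) = e , p , joins⇒incidentˡ j

    -- Before its first arrival at `x` a walk has no vertex `x`, hence no edge meeting `x`. This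
    -- supplies the last edge of a path into a leaf.
    first-visit : ∀ {u x} → u ≢ x → Linked P u x →
                  ∃[ z ] Linked (λ e → P e × ¬ Incident ends x e) u z × Adj P z x
    first-visit u≢x ε = contradiction refl u≢x
    first-visit {x = x} u≢x (_◅_ {j = u′} a@(e , p , j) w) with u′ ≟ x
    ... | yes refl = _ , ε , a
    ... | no u′≢x with first-visit u′≢x w
    ...   | z , w′ , a′ = z , (e , (p , avoids) , j) ◅ w′ , a′
      where
      avoids : ¬ Incident ends x e
      avoids i with incident-joins i j
      ... | inj₁ refl = u≢x refl
      ... | inj₂ refl = u′≢x refl

  walk⇒linked : ∀ {S Q u w} → WalkIn ends S Q u w → Linked (_∈E S) u w
  walk⇒linked here                = ε
  walk⇒linked (step e w e∈S j _)  = walk⇒linked w ◅◅ link e∈S j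

  linked⇒reach : ∀ {S u w} → Linked (_∈E S) u w → Reach ends S u w
  linked⇒reach {S} {u} = extend here
    where
    extend : ∀ {x w} → Reach ends S u x → Linked (_∈E S) x w → Reach ends S u w
    extend r ε                   = r
    extend r ((e , e∈S , j) ◅ w) = extend (step e r e∈S j tt) w

  -- Turns the avoidance of a vertex into a condition on edges, so that `linked?` can decide it.
  avoiding⇒linked : ∀ {S x u w} → u ≢ x → ReachAvoiding ends S x u w →
                    Linked (λ e → e ∈E S × ¬ Incident ends x e) u w × w ≢ x
  avoiding⇒linked u≢x here = ε , u≢x
  avoiding⇒linked {x = x} u≢x (step e w e∈S j y≢x) with avoiding⇒linked u≢x w
  ... | w′ , x′≢x = w′ ◅◅ link (e∈S , avoids) j , y≢x
    where
    avoids : ¬ Incident ends x e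
    avoids i = [ x′≢x ∘ sym , y≢x ∘ sym ]′ (incident-joins i j)

  -- Connected components and decidable connectivity.

  record Components (P : Fin m → Set) : Set where
    field
      label    : Fin n → Fin n
      sound    : ∀ {u w} → label u ≡ label w → Linked P u w
      edge     : ∀ e → P e → label (src e) ≡ label (proj₂ (ends e))

    adj-label : ∀ {e x y} → P e → Joins ends e x y → label x ≡ label y
    adj-label {e} p (inj₁ eq) =
      subst₂ (λ a b → label a ≡ label b) (cong proj₁ eq) (cong proj₂ eq) (edge e p)
    adj-label {e} p (inj₂ eq) =
      subst₂ (λ a b → label a ≡ label b) (cong proj₂ eq) (cong proj₁ eq) (sym (edge e p))

    complete : ∀ {u w} → Linked P u w → label u ≡ label w
    complete ε                 = refl
    complete ((e , p , j) ◅ w) = trans (adj-label p j) (complete w)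

    incident-label : ∀ {v e} → P e → Incident ends v e → label v ≡ label (src e)
    incident-label p (inj₁ refl) = refl
    incident-label p (inj₂ refl) = sym (edge _ p)

  private
    replace : Fin n → Fin n → Fin n → Fin n
    replace a b l with l ≟ a
    ... | yes _ = b
    ... | no _  = l

    replace-≡ : ∀ a b → replace a b a ≡ replace a b b
    replace-≡ a b with a ≟ a | b ≟ a
    ... | no a≢a | _     = contradiction refl a≢a
    ... | yes _  | yes _ = refl
    ... | yes _  | no _  = refl

    replace-inverse : ∀ a b {k l} → replace a b k ≡ replace a b l →
                      k ≡ l ⊎ (k ≡ a × b ≡ l) ⊎ (k ≡ b × a ≡ l)
    replace-inverse a b {k} {l} eq with k ≟ a | l ≟ a
    ... | yes q | yes r = inj₁ (trans q (sym r))
    ... | yes q | no _  = inj₂ (inj₁ (q , eq))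
    ... | no _  | yes r = inj₂ (inj₂ (eq , sym r))
    ... | no _  | no _  = inj₁ eq

  -- Starting from singletons, each edge satisfying `P` merges the classes of its ends by renaming
  -- one label to the other. Equal labels thus always come with a walk.
  components : {P : Fin m → Set} → Decidable P → Components P
  components {P} P? with merge (allFin m)
    where
    merge : ∀ es → ∃[ c ] (∀ {u w} → c u ≡ c w → Linked P u w) ×
                          (∀ e → e ∈ es → P e → c (src e) ≡ c (proj₂ (ends e)))
    merge [] = id , (λ { refl → ε }) , λ _ ()
    merge (e ∷ es) with merge es | P? e
    ... | c , sound , edge | no ¬p =
      c , sound , λ { _ (here refl) p → contradiction p ¬p ; f (there f∈) p → edge f f∈ p }
    ... | c , sound , edge | yes p =
      g ∘ c , sound′ , λ { _ (here refl) _ → ga≡gb ; f (there f∈) q → cong g (edge f f∈ q) }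
      where
      a b : Fin n
      a = src e
      b = proj₂ (ends e)
      a~b : Linked P a b
      a~b = link p (joins-ends e)
      g : Fin n → Fin n
      g = replace (c a) (c b)
      ga≡gb : g (c a) ≡ g (c b)
      ga≡gb = replace-≡ (c a) (c b)
      sound′ : ∀ {u w} → g (c u) ≡ g (c w) → Linked P u w
      sound′ eq with replace-inverse (c a) (c b) eq
      ... | inj₁ q              = sound q
      ... | inj₂ (inj₁ (q , r)) = sound q ◅◅ a~b ◅◅ sound r
      ... | inj₂ (inj₂ (q , r)) = sound q ◅◅ linked-sym a~b ◅◅ sound r
  ... | c , sound , edge = record
    { label = c ; sound = sound ; edge = λ e p → edge e (∈-allFin e) p }

  linked? : {P : Fin m → Set} → Decidable P → ∀ u w → Dec (Linked P u w)
  linked? P? u w with components P?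
  ... | C with Components.label C u ≟ Components.label C w
  ...   | yes eq = yes (Components.sound C eq)
  ...   | no ¬eq = no (¬eq ∘ Components.complete C)

  -- Breadth-first trees.

  record Parents (P : Fin m → Set) (c : Fin n) : Set where
    field
      rank    : Fin n → ℕ
      parent  : Fin n → Maybe (Fin m)
      descend : ∀ v e → parent v ≡ just e →
                P e × ∃[ u ] Joins ends e v u × rank u < rank v
      orphan  : ∀ v → parent v ≡ nothing → v ≡ c

    -- Two different vertices with the same parent edge would be its two ends, each of smaller rank
    -- than the other. Hence every vertex that gives up its parent edge loses an edge of its own.
    parent-injective : ∀ {v w e} → parent v ≡ just e → parent w ≡ just e → v ≡ w
    parent-injective {v} {w} p q with descend v _ p | descend w _ q
    ... | _ , _ , j , u<v | _ , _ , j′ , u′<w with joins-unique j j′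
    ...   | inj₁ (refl , _)    = refl
    ...   | inj₂ (refl , refl) = contradiction (<-trans u<v u′<w) (<-irrefl refl)

  module _ {P : Fin m → Set} (P? : Decidable P) (c : Fin n) where

    private
      -- Distance at most `k` from `c`; recursion on `k` makes it decidable, so that a least `k` can
      -- be found by search.
      Near : ℕ → Fin n → Set
      Near zero    v = v ≡ c
      Near (suc k) v = Near k v ⊎ ∃[ u ] Adj P v u × Near k u

      near? : ∀ k v → Dec (Near k v)
      near? zero    v = v ≟ c
      near? (suc k) v =
        near? k v ⊎-dec
        any? λ u → any? (λ e → P? e ×-dec joins-dec e v u) ×-dec near? k u

      near-mono : ∀ {j k v} → j ≤ k → Near j v → Near k v
      near-mono {k = zero}  z≤n     p = p
      near-mono {k = suc k} z≤n     p = inj₁ (near-mono {k = k} z≤n p)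
      near-mono (s≤s j≤k) (inj₁ p)           = inj₁ (near-mono j≤k p)
      near-mono (s≤s j≤k) (inj₂ (u , a , p)) = inj₂ (u , a , near-mono j≤k p)

      near : ∀ {v} → Linked P v c → ∃[ k ] Near k v
      near ε       = 0 , refl
      near (a ◅ w) with near w
      ... | k , p = suc k , inj₂ (_ , a , p)

      Distance : Fin n → ℕ → Set
      Distance v r = Near r v × (∀ j → Near j v → r ≤ j)

      distance : ∀ v k → Near k v → ∃ (Distance v)
      distance v zero    p = 0 , p , λ _ _ → z≤n
      distance v (suc k) p with near? k v
      ... | yes q = distance v k q
      ... | no ¬q = suc k , p , λ j q → ≰⇒> (λ j≤k → ¬q (near-mono j≤k q))

    parents : (∀ v → Linked P v c) → Parents P c
    parents conn = record
      { rank = rank ; parent = proj₁ ∘ choice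
      ; descend = λ v → proj₁ (proj₂ (choice v)) ; orphan = λ v → proj₂ (proj₂ (choice v)) }
      where
      rank-of : ∀ v → ∃ (Distance v)
      rank-of v = distance v _ (proj₂ (near (conn v)))
      rank : Fin n → ℕ
      rank = proj₁ ∘ rank-of
      choice : ∀ v → ∃[ p ] (∀ e → p ≡ just e → P e × ∃[ u ] Joins ends e v u × rank u < rank v) ×
                            (p ≡ nothing → v ≡ c)
      choice v with rank-of v
      ... | zero  , v≡c , _ = nothing , (λ _ ()) , λ _ → v≡c
      ... | suc k , inj₁ p , least = contradiction (least k p) (<-irrefl refl)
      ... | suc k , inj₂ (u , (e , p , j) , q) , _ =
        just e , (λ { _ refl → p , u , j , s≤s (proj₂ (proj₂ (rank-of u)) k q) }) , λ ()

  -- Degrees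

  ind : EdgeSet m → Fin n → Fin m → ℕ
  ind S v e = if S e ∧ incident? ends v e then 1 else 0

  degree-∑ : ∀ S v → degree ends S v ≡ ∑ (ind S v)
  degree-∑ S v = cong sum (map-tabulate id (ind S v))

  module _ {S : EdgeSet m} {v : Fin n} {e : Fin m} where

    ind⁺ : e ∈E S → Incident ends v e → ind S v e ≡ 1
    ind⁺ e∈S i with S e | proj₁ (ends e) ≟ v | proj₂ (ends e) ≟ v
    ... | true | yes _ | _     = refl
    ... | true | no _  | yes _ = refl
    ... | true | no p  | no q  = contradiction i [ p , q ]′

    ind-cases : (e ∈E S × Incident ends v e × ind S v e ≡ 1) ⊎
                (¬ (e ∈E S × Incident ends v e) × ind S v e ≡ 0)
    ind-cases with S e | proj₁ (ends e) ≟ v | proj₂ (ends e) ≟ v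
    ... | false | _     | _     = inj₂ ((λ { (() , _) }) , refl)
    ... | true  | yes p | _     = inj₁ (refl , inj₁ p , refl)
    ... | true  | no _  | yes q = inj₁ (refl , inj₂ q , refl)
    ... | true  | no p  | no q  = inj₂ ((λ { (_ , i) → [ p , q ]′ i }) , refl)

  ind-zero : ∀ {S v e} → ¬ e ∈E S → ind S v e ≡ 0
  ind-zero {S} {v} {e} e∉S with ind-cases {S} {v} {e}
  ... | inj₁ (e∈S , _) = contradiction e∈S e∉S
  ... | inj₂ (_ , eq)  = eq

  ind-≤ : ∀ {S v e k} → (e ∈E S → Incident ends v e → 1 ≤ k) → ind S v e ≤ k
  ind-≤ {S} {v} {e} h with ind-cases {S} {v} {e}
  ... | inj₁ (e∈S , i , eq) rewrite eq = h e∈S i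
  ... | inj₂ (_ , eq)       rewrite eq = z≤n

  ind-mono : ∀ {S S′ v e} → (e ∈E S → Incident ends v e → e ∈E S′) → ind S v e ≤ ind S′ v e
  ind-mono {S} {S′} h = ind-≤ {S} λ e∈S i → ≤-reflexive (sym (ind⁺ {S′} (h e∈S i) i))

-- The fate of an edge of T: in H, in H only until the M-edge e is added to H, or not in H.
data Label (m : ℕ) : Set where
  keep gone : Label m
  spare     : Fin m → Label m

keep≢gone : ∀ {m} → keep {m} ≢ gone
keep≢gone ()

spare≢gone : ∀ {m} {e : Fin m} → spare e ≢ gone
spare≢gone ()

keep≢spare : ∀ {m} {e : Fin m} → keep ≢ spare e
keep≢spare ()

keep? : ∀ {m} (l : Label m) → Dec (l ≡ keep)
keep? keep      = yes refl
keep? gone      = no λ ()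
keep? (spare _) = no λ ()

gone? : ∀ {m} (l : Label m) → Dec (l ≡ gone)
gone? keep      = no λ ()
gone? gone      = yes refl
gone? (spare _) = no λ ()

live-cases : ∀ {m} (l : Label m) → l ≢ gone → l ≡ keep ⊎ ∃[ e ] l ≡ spare e
live-cases keep      _  = inj₁ refl
live-cases gone      ¬g = contradiction refl ¬g
live-cases (spare e) _  = inj₂ (e , refl)

-- The components of `F` and their edges of `M`.

module Construction
  {n m} (ends : Ends n m) (loopless : Loopless ends) (F T M : EdgeSet m)
  (T-connected : Connected ends T) (matching : IsMatching ends M)
  (one : OneEdgePerComponent ends F M)
  (noncut : ∀ e → e ∈E M →
     ¬ CutVertex ends F (proj₁ (ends e)) ⊎ ¬ CutVertex ends F (proj₂ (ends e)))
  where

  open Graph ends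

  joins-distinct : ∀ {e x y} → Joins ends e x y → x ≢ y
  joins-distinct (inj₁ eq) refl = loopless _ (trans (cong proj₁ eq) (sym (cong proj₂ eq)))
  joins-distinct (inj₂ eq) refl = loopless _ (trans (cong proj₁ eq) (sym (cong proj₂ eq)))

  M⊆F : M ⊆E F
  M⊆F = proj₁ one

  Rest : Fin m → Set
  Rest e = e ∈E (F ∖E M)

  rest? : Decidable Rest
  rest? e = e ∈E? (F ∖E M)

  Rest⊆F : ∀ e → Rest e → e ∈E F
  Rest⊆F e r = proj₁ (∖E⁻ F M r)

  Rest∩M : ∀ e → Rest e → ¬ e ∈E M
  Rest∩M e r = proj₂ (∖E⁻ F M r)

  open Components (components (_∈E? F))
    renaming (label to comp; sound to comp-sound; complete to comp-complete;
              adj-label to adj-comp; incident-label to incident-comp)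

  compᴱ : Fin m → Fin n
  compᴱ e = comp (src e)

  M-unique : ∀ {e f} → e ∈E M → f ∈E M → compᴱ e ≡ compᴱ f → e ≡ f
  M-unique e∈M f∈M eq =
    proj₂ (proj₂ one) _ _ _ (M⊆F _ e∈M) e∈M f∈M here (linked⇒reach (comp-sound eq))

  M-covers : ∀ {e} → e ∈E F → ∃[ f ] f ∈E M × compᴱ e ≡ compᴱ f
  M-covers e∈F with proj₁ (proj₂ one) _ e∈F
  ... | f , f∈M , r = f , f∈M , comp-complete (walk⇒linked r)

  Loses : (Fin m → Label m) → Fin n → Set
  Loses lab v = ∃[ t ] t ∈E T × Incident ends v t × lab t ≡ gone

  -- What guarantees that the M-edge e can still be added to H when one of its ends
  -- would otherwise have too small a degree.
  data Reserve (lab : Fin m → Label m) (e : Fin m) : Set where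
    leaf   : ∀ {x y} → Joins ends e x y → (∀ f → Rest f → ¬ Incident ends x f) → Reserve lab e
    spared : ∀ {a b t} → Joins ends e a b → Incident ends b t → lab t ≡ spare e → Reserve lab e
    lossy  : (∀ v → Incident ends v e → Loses lab v) → Reserve lab e

  module _ {lab lab′ : Fin m → Label m} (gone-mono : ∀ t → lab t ≡ gone → lab′ t ≡ gone) where

    loses-mono : ∀ {v} → Loses lab v → Loses lab′ v
    loses-mono (t , t∈T , i , g) = t , t∈T , i , gone-mono t g

    reserve-mono : ∀ {e} → (∀ t → lab t ≡ spare e → lab′ t ≡ spare e) →
                   Reserve lab e → Reserve lab′ e
    reserve-mono s (leaf j ¬r)    = leaf j ¬r
    reserve-mono s (spared j i q) = spared j i (s _ q)
    reserve-mono s (lossy h)      = lossy λ v i → loses-mono (h v i)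

  -- Contracting the components of F one at a time

  -- Contraction without a quotient graph: a treated component, with label in `ks`, is represented
  -- by its edges of `Rest`.
  Backbone : (Fin m → Label m) → List (Fin n) → Fin m → Set
  Backbone lab ks t = lab t ≡ keep ⊎ (Rest t × compᴱ t ∈ ks)

  M-free : Fin n → Set
  M-free v = ∀ e → e ∈E M → ¬ Incident ends v e

  -- In treated components the ends of `M`-edges are exempt from losing an edge; a reserve takes its
  -- place. There, by `spare-Rest` and `keep-Rest`, no live edge (one not `gone`) lies in `Rest`, so
  -- no edge is counted twice.
  record Stage (ks : List (Fin n)) : Set where
    field
      lab         : Fin m → Label m
      lab-T       : ∀ t → lab t ≢ gone → t ∈E T
      spare-Rest  : ∀ t e → lab t ≡ spare e → ¬ Rest t
      keep-Rest   : ∀ t → lab t ≡ keep → Rest t → compᴱ t ∉ ks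
      connected   : ∀ u w → Linked (Backbone lab ks) u w
      free-loses  : ∀ v → comp v ∈ ks → M-free v → Loses lab v
      reserve     : ∀ e → e ∈E M → compᴱ e ∈ ks → Reserve lab e

  initial : Stage []
  initial = record
    { lab = lab ; lab-T = λ t → lab-T t ; spare-Rest = λ t e → lab-spare t
    ; keep-Rest = λ _ _ _ () ; free-loses = λ _ () ; reserve = λ _ _ ()
    ; connected = λ u w → linked-map (λ t → inj₁ ∘ T-lab t) (walk⇒linked (T-connected u w)) }
    where
    lab : Fin m → Label m
    -- Edges outside `T` are `gone` from the outset, so that live edges lie in `T`; therefore
    -- `Loses` asks for `t ∈E T` separately.
    lab t = if T t then keep else gone
    lab-T : ∀ t → lab t ≢ gone → t ∈E T
    lab-T t ¬g with T t
    ... | true  = refl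
    ... | false = contradiction refl ¬g
    lab-spare : ∀ t {e} {A : Set} → lab t ≡ spare e → A
    lab-spare t eq with T t | eq
    ... | true  | ()
    ... | false | ()
    T-lab : ∀ t → t ∈E T → lab t ≡ keep
    T-lab t t∈T rewrite t∈T = refl

  -- An edge of `Rest` in the backbone belongs to a treated component, so it cannot meet an
  -- untreated one.
  fresh-keep : ∀ {ks v e t} (S : Stage ks) → compᴱ e ∉ ks → Backbone (Stage.lab S) ks t →
               Incident ends v t → comp v ≡ compᴱ e → Stage.lab S t ≡ keep
  fresh-keep S fresh (inj₁ k)        i eq = k
  fresh-keep {t = t} S fresh (inj₂ (r , c∈)) i eq =
    contradiction (subst (_∈ _) (trans (sym (incident-comp (Rest⊆F t r) i)) eq) c∈) fresh

  -- Only the vertices of D, a part of the component of e, give up their parent edges in a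
  -- tree rooted at c. Every other vertex keeps its parent edge, hence can descend until it
  -- meets D, and D is connected by the edges of F ∖ M.
  module Contract
    {ks : List (Fin n)} (S : Stage ks) {e : Fin m} (e∈M : e ∈E M) (fresh : compᴱ e ∉ ks)
    {c : Fin n} (tree : Parents (Backbone (Stage.lab S) ks) c)
    {D : Fin n → Set} (D? : Decidable D) (D-comp : ∀ v → D v → comp v ≡ compᴱ e)
    (D-linked : ∀ v → D v → Linked (λ f → Rest f × compᴱ f ≡ compᴱ e) v c)
    {Mark : Fin m → Set} (mark? : Decidable Mark) (mark-Rest : ∀ t → Mark t → ¬ Rest t)
    where

    open Stage S
    open Parents tree

    Hit : Fin m → Set
    Hit t = (∃[ v ] D v × parent v ≡ just t) ⊎ (Rest t × compᴱ t ≡ compᴱ e)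

    hit? : Decidable Hit
    hit? t = any? (λ v → D? v ×-dec Maybe.≡-dec _≟_ (parent v) (just t)) ⊎-dec
             (rest? t ×-dec (compᴱ t ≟ compᴱ e))

    data Relabel (t : Fin m) : Label m → Set where
      same : lab t ≢ keep ⊎ ¬ Hit t → Relabel t (lab t)
      drop : lab t ≡ keep → Hit t → ¬ Mark t → Relabel t gone
      save : lab t ≡ keep → Hit t → Mark t → Relabel t (spare e)

    abstract
      relabel : ∀ t → ∃ (Relabel t)
      relabel t with keep? (lab t) | hit? t | mark? t
      ... | no ¬k | _      | _     = _ , same (inj₁ ¬k)
      ... | yes _ | no ¬h  | _     = _ , same (inj₂ ¬h)
      ... | yes k | yes h  | no ¬μ = _ , drop k h ¬μ
      ... | yes k | yes h  | yes μ = _ , save k h μ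

    lab′ : Fin m → Label m
    lab′ = proj₁ ∘ relabel

    gone-mono : ∀ t → lab t ≡ gone → lab′ t ≡ gone
    gone-mono t g with relabel t
    ... | _ , same _     = g
    ... | _ , drop _ _ _ = refl
    ... | _ , save k _ _ with () ← trans (sym k) g

    spare-mono : ∀ {f} t → lab t ≡ spare f → lab′ t ≡ spare f
    spare-mono t s with relabel t
    ... | _ , same _     = s
    ... | _ , drop k _ _ with () ← trans (sym k) s
    ... | _ , save k _ _ with () ← trans (sym k) s

    lab′-T : ∀ t → lab′ t ≢ gone → t ∈E T
    lab′-T t ¬g = lab-T t (¬g ∘ gone-mono t)

    keep-back : ∀ t → lab′ t ≡ keep → lab t ≡ keep × ¬ Hit t
    keep-back t k with relabel t
    ... | _ , same (inj₁ ¬k) = contradiction k ¬k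
    ... | _ , same (inj₂ ¬h) = k , ¬h

    keep-stays : ∀ t → lab t ≡ keep → ¬ Hit t → lab′ t ≡ keep
    keep-stays t k ¬h with relabel t
    ... | _ , same _     = k
    ... | _ , drop _ h _ = contradiction h ¬h
    ... | _ , save _ h _ = contradiction h ¬h

    hit-gone : ∀ t → lab t ≡ keep → Hit t → ¬ Mark t → lab′ t ≡ gone
    hit-gone t k h ¬μ with relabel t
    ... | _ , same (inj₁ ¬k) = contradiction k ¬k
    ... | _ , same (inj₂ ¬h) = contradiction h ¬h
    ... | _ , drop _ _ _     = refl
    ... | _ , save _ _ μ     = contradiction μ ¬μ

    hit-spare : ∀ t → lab t ≡ keep → Hit t → Mark t → lab′ t ≡ spare e
    hit-spare t k h μ with relabel t
    ... | _ , same (inj₁ ¬k) = contradiction k ¬k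
    ... | _ , same (inj₂ ¬h) = contradiction h ¬h
    ... | _ , drop _ _ ¬μ    = contradiction μ ¬μ
    ... | _ , save _ _ _     = refl

    spare-Rest′ : ∀ t f → lab′ t ≡ spare f → ¬ Rest t
    spare-Rest′ t f s with relabel t
    ... | _ , same _     = spare-Rest t f s
    ... | _ , save _ _ μ = mark-Rest t μ

    hit-loses : ∀ {v t} → lab t ≡ keep → Incident ends v t → Hit t → ¬ Mark t → Loses lab′ v
    hit-loses {t = t} k i h ¬μ =
      t , lab-T t (λ g → keep≢gone (trans (sym k) g)) , i , hit-gone t k h ¬μ

    parent-incident : ∀ {v t} → parent v ≡ just t → Incident ends v t
    parent-incident p with descend _ _ p
    ... | _ , _ , j , _ = joins⇒incidentˡ j

    parent-keep : ∀ {v t} → D v → parent v ≡ just t → lab t ≡ keep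
    parent-keep d p = fresh-keep S fresh (proj₁ (descend _ _ p)) (parent-incident p) (D-comp _ d)

    parent-loses : ∀ {v} → D v → v ≢ c → (∀ t → parent v ≡ just t → ¬ Mark t) → Loses lab′ v
    parent-loses {v} d v≢c ¬μ with parent v in eq
    ... | nothing = contradiction (orphan v eq) v≢c
    ... | just t  =
      hit-loses (parent-keep d eq) (parent-incident eq) (inj₁ (v , d , eq)) (¬μ t refl)

    parent-spare : ∀ {v t} → D v → parent v ≡ just t → Mark t → lab′ t ≡ spare e
    parent-spare d p = hit-spare _ (parent-keep d p) (inj₁ (_ , d , p))

    Backbone′ : Fin m → Set
    Backbone′ = Backbone lab′ (compᴱ e ∷ ks)

    linked-root : ∀ v → Acc _<_ (rank v) → Linked Backbone′ v c
    linked-root v (acc rec) with D? v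
    ... | yes d = linked-map (λ { _ (r , eq) → inj₂ (r , here eq) }) (D-linked v d)
    ... | no ¬d with parent v in eq
    ...   | nothing rewrite orphan v eq = ε
    ...   | just t with descend v t eq
    ...     | p , u , j , u<v = link (stays p) j ◅◅ linked-root u (rec u<v)
      where
      stays : Backbone lab ks t → Backbone′ t
      stays (inj₂ (r , c∈)) = inj₂ (r , there c∈)
      stays (inj₁ k) with hit? t
      ... | no ¬h                    = inj₁ (keep-stays t k ¬h)
      ... | yes (inj₂ (r , c≡))      = inj₂ (r , here c≡)
      -- The vertex `w` of `D` would share its parent edge with `v`, so it would be `v`, which lies
      -- outside `D`.
      ... | yes (inj₁ (w , dw , eq′)) with refl ← parent-injective eq eq′ = contradiction dw ¬d

    contract : Reserve lab′ e → (∀ v → comp v ≡ compᴱ e → M-free v → Loses lab′ v) →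
               Stage (compᴱ e ∷ ks)
    contract reserve-e free-e = record
      { lab = lab′ ; lab-T = lab′-T ; spare-Rest = spare-Rest′
      ; keep-Rest = λ
          { t k r (here eq) → proj₂ (keep-back t k) (inj₂ (r , eq))
          ; t k r (there c∈) → keep-Rest t (proj₁ (keep-back t k)) r c∈ }
      ; connected = λ u w → linked-root u (<-wellFounded _) ◅◅
                            linked-sym (linked-root w (<-wellFounded _))
      ; free-loses = λ
          { v (here eq) free → free-e v eq free
          ; v (there c∈) free → loses-mono gone-mono (free-loses v c∈ free) }
      ; reserve = λ
          { f f∈M (here eq) → subst (Reserve lab′) (sym (M-unique f∈M e∈M eq)) reserve-e
          ; f f∈M (there c∈) → reserve-mono gone-mono spare-mono (reserve f f∈M c∈) } }

  -- Choosing the root and the reserve for a new component.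

  module Extend {ks} (S : Stage ks) {e} (e∈M : e ∈E M) (fresh : compᴱ e ∉ ks) where

    open Stage S

    Inner : Fin m → Set
    Inner f = Rest f × compᴱ f ≡ compᴱ e

    tree : ∀ c → Parents (Backbone lab ks) c
    tree c = parents (λ t → keep? (lab t) ⊎-dec (rest? t ×-dec _∈?_ _≟_ (compᴱ t) ks)) c
                     (λ v → connected v c)

    not-incident : ∀ {v w} → M-free v → Incident ends w e → v ≢ w
    not-incident free i refl = free e e∈M i

    -- As `t` is not in `Rest`, it can be saved for `e` instead of being dropped. Apart from the
    -- root `a`, only `b` fails to lose its parent edge, and both are exempt as ends of `e`.
    contract-spare :
      ∀ {a b t} → Joins ends e a b → (∀ v → comp v ≡ compᴱ e → Linked Inner v a) →
      Parents.parent (tree a) b ≡ just t → ¬ Rest t → Stage (compᴱ e ∷ ks)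
    contract-spare {a} {b} {t} j linked p ¬r =
      contract
        (spared j (parent-incident p) (parent-spare b-comp p refl))
        (λ v eq free → parent-loses eq (not-incident free (joins⇒incidentˡ j))
          λ { _ q refl → not-incident free (joins⇒incidentʳ j) (parent-injective q p) })
      where
      t-spareable : ∀ t′ → t′ ≡ t → ¬ Rest t′
      t-spareable _ refl = ¬r
      open Parents (tree a)
      open Contract S e∈M fresh (tree a) (λ v → comp v ≟ compᴱ e) (λ _ → id) linked
                    (_≟ t) t-spareable
      b-comp : comp b ≡ compᴱ e
      b-comp = incident-comp (M⊆F e e∈M) (joins⇒incidentʳ j)

    module _ {x y} (j : Joins ends e x y) (x-noncut : ¬ CutVertex ends F x) where

      e-x : Incident ends x e
      e-x = joins⇒incidentˡ j

      e-y : Incident ends y e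
      e-y = joins⇒incidentʳ j

      x-comp : comp x ≡ compᴱ e
      x-comp = incident-comp (M⊆F e e∈M) e-x

      y-comp : comp y ≡ compᴱ e
      y-comp = incident-comp (M⊆F e e∈M) e-y

      y≢x : y ≢ x
      y≢x = joins-distinct (joins-sym j)

      Away : Fin m → Set
      Away f = f ∈E F × ¬ Incident ends x f

      away? : Decidable Away
      away? f = (f ∈E? F) ×-dec ¬? (incident-dec x f)

      -- The only edge of `M` in this component is `e`, which meets `x`; a walk avoiding the edges
      -- at `x` thus uses no edge of `M`.
      away⇒inner : ∀ {u w} → comp u ≡ compᴱ e → Linked Away u w → Linked Inner u w
      away⇒inner eq ε = ε
      away⇒inner {u} eq ((f , (f∈F , ¬i) , j′) ◅ w) =
        (f , (∖E⁺ F M f∈F f∉M , f-comp) , j′) ◅ away⇒inner (trans (sym (adj-comp f∈F j′)) eq) w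
        where
        f-comp : compᴱ f ≡ compᴱ e
        f-comp = trans (sym (incident-comp f∈F (joins⇒incidentˡ j′))) eq
        f∉M : ¬ f ∈E M
        f∉M f∈M with refl ← M-unique f∈M e∈M f-comp = ¬i e-x

      -- As `x` is not a cut vertex, `u` and `y` are linked in `F` without `x`. Deciding the link
      -- first turns the negative hypothesis `x-noncut` into an actual walk.
      linked-y : ∀ u → comp u ≡ compᴱ e → u ≢ x → Linked Inner u y
      linked-y u eq u≢x with linked? away? u y
      ... | yes w = away⇒inner eq w
      ... | no ¬w = contradiction
        (u , y , u≢x , y≢x , linked⇒reach (comp-sound (trans eq (sym y-comp))) ,
         λ w → ¬w (proj₁ (avoiding⇒linked u≢x w)))
        x-noncut

      -- Here `e` is the only edge of `F` at `x`. Edges of `Rest` cannot reach `x`, so it is left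
      -- out of `D`; being an end of `e`, it need not lose an edge yet.
      extend-leaf : (∀ f → Rest f → ¬ Incident ends x f) → Stage (compᴱ e ∷ ks)
      extend-leaf ¬r =
        contract (leaf j ¬r)
          (λ v eq free → parent-loses (eq , not-incident free e-x) (not-incident free e-y) λ _ _ ())
        where
        open Contract S e∈M fresh (tree y) {λ v → comp v ≡ compᴱ e × v ≢ x}
               (λ v → (comp v ≟ compᴱ e) ×-dec ¬? (v ≟ x)) (λ _ → proj₁)
               (λ v d → linked-y v (proj₁ d) (proj₂ d))
               {λ _ → ⊥} (λ _ → no id) (λ _ ())

      module _ {f} (r : Rest f) (i : Incident ends x f) where

        -- The edge `f` leads from `x` to a neighbour other than `x`, so now the whole component can
        -- serve as `D`.
        to-y : ∀ v → comp v ≡ compᴱ e → Linked Inner v y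
        to-y v eq with v ≟ x
        ... | no v≢x = linked-y v eq v≢x
        ... | yes refl with incident⇒joins i
        ...   | z , j′ = link (r , trans (sym (incident-comp f∈F i)) eq) j′ ◅◅
                         linked-y z (trans (sym (adj-comp f∈F j′)) eq)
                                    (joins-distinct (joins-sym j′))
          where
          f∈F : f ∈E F
          f∈F = Rest⊆F f r

        to-x : ∀ v → comp v ≡ compᴱ e → Linked Inner v x
        to-x v eq = to-y v eq ◅◅ linked-sym (to-y x x-comp)

        -- With root `x`, the end `y` gives up its parent edge, while `x` loses `t`, a kept edge of
        -- `T` that is itself in `Rest`.
        extend-lossy : ∀ {t} → Rest t → Parents.parent (tree y) x ≡ just t → Stage (compᴱ e ∷ ks)
        extend-lossy {t} rt q = contract (lossy ends-lose)
          (λ v eq free → parent-loses eq (not-incident free e-x) λ _ _ ())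
          where
          open Contract S e∈M fresh (tree x) (λ v → comp v ≟ compᴱ e) (λ _ → id) to-x
                 {λ _ → ⊥} (λ _ → no id) (λ _ ())
          ends-lose : ∀ v → Incident ends v e → Loses lab′ v
          ends-lose v i′ with incident-joins i′ j | Parents.descend (tree y) x t q
          ... | inj₂ refl | _ = parent-loses y-comp y≢x λ _ _ ()
          ... | inj₁ refl | b , _ , j′ , _ =
            hit-loses (fresh-keep S fresh b t-x x-comp) t-x
              (inj₂ (rt , trans (sym (incident-comp (Rest⊆F t rt) t-x)) x-comp)) λ ()
            where
            t-x : Incident ends x t
            t-x = joins⇒incidentˡ j′

        -- The parent edge of one end of `e` in the tree rooted at the other can be spared if it is
        -- not in `Rest`. If both such edges are in `Rest`, both ends lose an edge at once.
        extend-inner : Stage (compᴱ e ∷ ks)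
        extend-inner with Parents.parent (tree x) y in p | Parents.parent (tree y) x in q
        ... | nothing | _       = contradiction (Parents.orphan (tree x) y p) y≢x
        ... | just _  | nothing = contradiction (sym (Parents.orphan (tree y) x q)) y≢x
        ... | just s  | just t with rest? s | rest? t
        ...   | no ¬s | _      = contract-spare j to-x p ¬s
        ...   | yes _ | no ¬t  = contract-spare (joins-sym j) to-y q ¬t
        ...   | yes _ | yes rt = extend-lossy rt q

      extend-noncut : Stage (compᴱ e ∷ ks)
      extend-noncut with any? (λ f → rest? f ×-dec incident-dec x f)
      ... | yes (f , r , i) = extend-inner r i
      ... | no none         = extend-leaf λ f r i → none (f , r , i)

    extend : Stage (compᴱ e ∷ ks)
    extend with noncut e e∈M
    ... | inj₁ ¬c = extend-noncut (joins-ends e) ¬c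
    ... | inj₂ ¬c = extend-noncut (joins-sym (joins-ends e)) ¬c

  stages : ∀ es → ∃[ ks ] Stage ks × (∀ e → e ∈ es → e ∈E M → compᴱ e ∈ ks)
  stages [] = [] , initial , λ _ ()
  stages (e ∷ es) with stages es | e ∈E? M
  ... | ks , S , all | no e∉M =
    ks , S , λ { _ (here refl) e∈M → contradiction e∈M e∉M ; f (there f∈) → all f f∈ }
  ... | ks , S , all | yes e∈M with _∈?_ _≟_ (compᴱ e) ks
  ...   | yes c∈ = ks , S , λ { _ (here refl) _ → c∈ ; f (there f∈) → all f f∈ }
  ...   | no c∉  = compᴱ e ∷ ks , Extend.extend S e∈M c∉ ,
                   λ { _ (here refl) _ → here refl ; f (there f∈) f∈M → there (all f f∈ f∈M) }

  -- Adding edges of M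

  -- The part of `H` that keeps it connected. Spare edges are left out, so that removing one is
  -- harmless.
  Core : (Fin m → Label m) → EdgeSet m → Fin m → Set
  Core lab Q t = lab t ≡ keep ⊎ t ∈E (F ∖E Q)

  -- An end of an edge of `Q` may be one edge short in `H`; a live edge of `T`, never in `Rest`,
  -- makes up for it.
  Touched : (Fin m → Label m) → Fin n → Set
  Touched lab v = ∃[ t ] lab t ≢ gone × Incident ends v t

  -- Q consists of the edges of M that are not in H.
  record Pending (Q : EdgeSet m) : Set where
    field
      lab       : Fin m → Label m
      lab-T     : ∀ t → lab t ≢ gone → t ∈E T
      lab-Rest  : ∀ t → lab t ≢ gone → ¬ Rest t
      Q⊆M       : Q ⊆E M
      connected : ∀ u w → Linked (Core lab Q) u w
      loses     : ∀ v f → f ∈E F → Incident ends v f → (∀ e → e ∈E Q → ¬ Incident ends v e) →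
                  Loses lab v
      reserve   : ∀ e → e ∈E Q → Reserve lab e

  -- Every non-trivial component of `F` contains an edge of `M`, so none is left untreated.
  start : Pending M
  start with stages (allFin m)
  ... | ks , S , all = record
    { lab = lab ; lab-T = lab-T ; lab-Rest = lab-Rest ; Q⊆M = λ _ → id
    ; connected = λ u w → linked-map (λ { _ (inj₁ k) → inj₁ k ; _ (inj₂ (r , _)) → inj₂ r })
                                     (connected u w)
    ; loses = λ v f f∈F i free →
        free-loses v (subst (_∈ ks) (sym (incident-comp f∈F i)) (F-comp f∈F)) free
    ; reserve = λ e e∈M → reserve e e∈M (all e (∈-allFin e) e∈M) }
    where
    open Stage S
    F-comp : ∀ {f} → f ∈E F → compᴱ f ∈ ks
    F-comp f∈F with M-covers f∈F
    ... | e , e∈M , eq = subst (_∈ ks) (sym eq) (all e (∈-allFin e) e∈M)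
    lab-Rest : ∀ t → lab t ≢ gone → ¬ Rest t
    lab-Rest t ¬g r with live-cases (lab t) ¬g
    ... | inj₁ k       = keep-Rest t k r (F-comp (Rest⊆F t r))
    ... | inj₂ (e , s) = spare-Rest t e s r

  module Advance {Q : EdgeSet m} (P : Pending Q) {e} (e∈Q : e ∈E Q) where

    open Pending P

    Q′ : EdgeSet m
    Q′ = delete Q e

    F∖Q⊆F∖Q′ : (F ∖E Q) ⊆E (F ∖E Q′)
    F∖Q⊆F∖Q′ f f∈ with ∖E⁻ F Q f∈
    ... | f∈F , f∉Q = ∖E⁺ F Q′ f∈F (f∉Q ∘ proj₁ ∘ delete⁻ Q)

    e∈F∖Q′ : e ∈E (F ∖E Q′)
    e∈F∖Q′ = ∖E⁺ F Q′ (M⊆F e (Q⊆M e e∈Q)) (λ e∈Q′ → proj₂ (delete⁻ Q e∈Q′) refl)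

    -- With `e` out of `Q` its ends are no longer exempt and must have lost an edge of `T`. Edges
    -- spared for `e` may be given up; all other spares must survive.
    add-edge : (lab′ : Fin m → Label m) → (∀ t → lab t ≡ gone → lab′ t ≡ gone) →
               (∀ f → f ≢ e → ∀ t → lab t ≡ spare f → lab′ t ≡ spare f) →
               (∀ u w → Linked (Core lab′ Q′) u w) →
               (∀ v → Incident ends v e → Loses lab′ v) →
               Pending Q′
    add-edge lab′ gone-mono spare-mono connected′ ends-lose = record
      { lab = lab′
      ; lab-T = λ t ¬g → lab-T t (¬g ∘ gone-mono t)
      ; lab-Rest = λ t ¬g → lab-Rest t (¬g ∘ gone-mono t)
      ; Q⊆M = λ f → Q⊆M f ∘ proj₁ ∘ delete⁻ Q
      ; connected = connected′
      ; loses = loses′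
      ; reserve = λ f f∈Q′ → let f∈Q , f≢e = delete⁻ Q f∈Q′ in
          reserve-mono gone-mono (spare-mono f f≢e) (reserve f f∈Q) }
      where
      loses′ : ∀ v f → f ∈E F → Incident ends v f → (∀ f → f ∈E Q′ → ¬ Incident ends v f) →
               Loses lab′ v
      loses′ v f f∈F i free with incident-dec v e
      ... | yes v-e = ends-lose v v-e
      ... | no ¬v-e = loses-mono gone-mono (loses v f f∈F i free-Q)
        where
        free-Q : ∀ f → f ∈E Q → ¬ Incident ends v f
        free-Q f f∈Q v-f with f ≟ e
        ... | yes refl = ¬v-e v-f
        ... | no f≢e   = free f (delete⁺ Q f∈Q f≢e) v-f

    -- Connectedness of `T` gives `v` an edge of `T`, and as no edge at `v` is live, this one is
    -- gone.
    untouched-loses : ∀ {v w} → v ≢ w → ¬ Touched lab v → Loses lab v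
    untouched-loses v≢w ¬τ with first-edge v≢w (walk⇒linked (T-connected _ _))
    ... | t , t∈T , i with gone? (lab t)
    ...   | yes g = t , t∈T , i , g
    ...   | no ¬g = contradiction (t , ¬g , i) ¬τ

    module Kill (s : Fin m) where

      kill : Fin m → Label m
      kill t with t ≟ s
      ... | yes _ = gone
      ... | no _  = lab t

      kill-s : kill s ≡ gone
      kill-s with s ≟ s
      ... | yes _  = refl
      ... | no s≢s = contradiction refl s≢s

      kill-other : ∀ t → t ≢ s → kill t ≡ lab t
      kill-other t t≢s with t ≟ s
      ... | yes t≡s = contradiction t≡s t≢s
      ... | no _    = refl

      kill-gone : ∀ t → lab t ≡ gone → kill t ≡ gone
      kill-gone t g with t ≟ s
      ... | yes _ = refl
      ... | no _  = g

      kill-core : ∀ f → (lab f ≡ keep → f ≢ s) → Core lab Q f → Core kill Q′ f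
      kill-core f f≢s (inj₁ k)  = inj₁ (trans (kill-other f (f≢s k)) k)
      kill-core f f≢s (inj₂ f∈) = inj₂ (F∖Q⊆F∖Q′ f f∈)

      kill-loses : ∀ {v} → lab s ≢ gone → Incident ends v s → Loses kill v
      kill-loses ¬g i = s , lab-T s ¬g , i , kill-s

    add-lossy : (∀ v → Incident ends v e → Loses lab v) → Pending Q′
    add-lossy = add-edge lab (λ _ → id) (λ _ _ _ → id)
      (λ u w → linked-map (λ { _ (inj₁ k) → inj₁ k ; f (inj₂ f∈) → inj₂ (F∖Q⊆F∖Q′ f f∈) })
                          (connected u w))

    -- The deficient end `a` has lost an edge already, and `b` gives up `t`, which `Core` does not
    -- contain.
    add-spared : ∀ {a b t} → Joins ends e a b → Incident ends b t → lab t ≡ spare e →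
                 ¬ Touched lab a → Pending Q′
    add-spared {a} {b} {t} j i s ¬τ = add-edge kill kill-gone
      (λ f f≢e t′ s′ →
        trans (kill-other t′ λ { refl → f≢e (spare-injective (trans (sym s′) s)) }) s′)
      (λ u w → linked-map (λ f → kill-core f λ k → λ { refl → not-keep k }) (connected u w))
      λ v i′ → [ (λ { refl → loses-mono kill-gone (untouched-loses (joins-distinct j) ¬τ) })
               , (λ { refl → kill-loses ¬g i }) ]′ (incident-joins i′ j)
      where
      open Kill t
      spare-injective : ∀ {f g : Fin m} → spare f ≡ spare g → f ≡ g
      spare-injective refl = refl
      ¬g : lab t ≢ gone
      ¬g g with () ← trans (sym s) g
      not-keep : lab t ≢ keep
      not-keep k with () ← trans (sym s) k

    module _ {x y} (j : Joins ends e x y) (¬r : ∀ f → Rest f → ¬ Incident ends x f) where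

      -- By the matching property the only edge of `F` at `x` is `e`, which still belongs to `Q`.
      leaf-core : ∀ {f} → Core lab Q f → Incident ends x f → lab f ≡ keep
      leaf-core (inj₁ k) i = k
      leaf-core {f} (inj₂ f∈) i with ∖E⁻ F Q f∈ | f ∈E? M
      ... | f∈F , f∉Q | no f∉M = contradiction i (¬r f (∖E⁺ F M f∈F f∉M))
      ... | f∈F , f∉Q | yes f∈M with refl ← matching f e x f∈M (Q⊆M e e∈Q) i (joins⇒incidentˡ j) =
        contradiction e∈Q f∉Q

      -- `Core` connects `x` to `y`, and its edges at `x` are kept edges of `T`. Hence only `y` can
      -- be the deficient end.
      leaf-touched : Touched lab x
      leaf-touched with first-edge (joins-distinct j) (connected x y)
      ... | f , c , i = f , (λ g → keep≢gone (trans (sym (leaf-core c i)) g)) , i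

      -- H has a path from y to x; once e is added, its last edge is no longer needed.
      add-leaf : ¬ Touched lab y → Pending Q′
      add-leaf ¬τ with first-visit (joins-distinct (joins-sym j)) (connected y x)
      ... | z , y~z , t , c , z-t-x = add-edge kill kill-gone
        (λ f f≢e t′ s → trans (kill-other t′ λ { refl → keep≢spare (trans (sym k) s) }) s)
        (λ u w → (detour ⋆) (connected u w))
        λ v i → [ (λ { refl → kill-loses (λ g → keep≢gone (trans (sym k) g)) t-x })
                , (λ { refl → loses-mono kill-gone (untouched-loses y≢x ¬τ) })
                ]′ (incident-joins i j)
        where
        open Kill t
        y≢x : y ≢ x
        y≢x = joins-distinct (joins-sym j)
        t-x : Incident ends x t
        t-x = joins⇒incidentʳ z-t-x
        k : lab t ≡ keep
        k = leaf-core c t-x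
        z~x : Linked (Core kill Q′) z x
        -- From `z` the part of the path avoiding `x` leads back to `y`, and `e` leads on to `x`.
        z~x = linked-sym
                (linked-map (λ { f (c′ , ¬i) → kill-core f (λ { _ refl → ¬i t-x }) c′ }) y~z)
              ◅◅ link (inj₂ e∈F∖Q′) (joins-sym j)
        detour : ∀ {u w} → Adj (Core lab Q) u w → Linked (Core kill Q′) u w
        detour (f , c′ , j′) with f ≟ t
        ... | no f≢t = link (kill-core f (λ _ → f≢t) c′) j′
        ... | yes refl with joins-unique z-t-x j′
        ...   | inj₁ (refl , refl) = z~x
        ...   | inj₂ (refl , refl) = linked-sym z~x

    advance : ∀ {v} → Incident ends v e → ¬ Touched lab v → Pending Q′
    advance i ¬τ with reserve e e∈Q
    ... | lossy h = add-lossy h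
    ... | spared {t = t} j i′ s with incident-joins i j
    ...   | inj₁ refl = add-spared j i′ s ¬τ
    ...   | inj₂ refl =
      contradiction (t , (λ g → spare≢gone (trans (sym s) g)) , i′) ¬τ
    advance i ¬τ | leaf j ¬r with incident-joins i j
    ...   | inj₁ refl = contradiction (leaf-touched j ¬r) ¬τ
    ...   | inj₂ refl = add-leaf j ¬r ¬τ

  -- The degree bounds and the final subgraph.

  Solution : Set
  Solution =
    ∃[ H ] (Connected ends H × (F ∖E M) ⊆E H ×
      (∀ v → degree ends F v ≤ degree ends H v ×
             degree ends H v ≤ degree ends T v + (degree ends F v ∸ 1)))

  module Finish {Q : EdgeSet m} (P : Pending Q)
    (touched : ∀ e v → e ∈E Q → Incident ends v e → Touched (Pending.lab P) v) where

    open Pending P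

    -- Spare edges are included: they count towards degrees while their edge of `M` is pending.
    H : EdgeSet m
    H t = (F ∖E Q) t ∨ not ⌊ gone? (lab t) ⌋

    F∖Q⊆H : (F ∖E Q) ⊆E H
    F∖Q⊆H t t∈ rewrite t∈ = refl

    live⊆H : ∀ t → lab t ≢ gone → t ∈E H
    live⊆H t ¬g with gone? (lab t)
    ... | yes g = contradiction g ¬g
    ... | no _  = Bool.∨-zeroʳ _

    H⁻ : ∀ t → t ∈E H → t ∈E (F ∖E Q) ⊎ lab t ≢ gone
    H⁻ t t∈H with (F ∖E Q) t | gone? (lab t)
    ... | true  | _     = inj₁ refl
    ... | false | no ¬g = inj₂ ¬g

    H-connected : Connected ends H
    H-connected u w = linked⇒reach (linked-map core⊆H (connected u w))
      where
      core⊆H : ∀ t → Core lab Q t → t ∈E H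
      core⊆H t (inj₁ k) = live⊆H t λ g → keep≢gone (trans (sym k) g)
      core⊆H t (inj₂ t∈) = F∖Q⊆H t t∈

    Rest⊆H : (F ∖E M) ⊆E H
    Rest⊆H t r = F∖Q⊆H t (∖E⁺ F Q (Rest⊆F t r) (Rest∩M t r ∘ Q⊆M t))

    module _ (v : Fin n) where

      h t f : Fin m → ℕ
      h = ind H v
      t = ind T v
      f = ind F v

      lower : ∑ f ≤ ∑ h
      lower with any? (λ e → (e ∈E? Q) ×-dec incident-dec v e)
      ... | no none = ∑-mono λ e → ind-mono {F} {H} λ e∈F i →
        F∖Q⊆H e (∖E⁺ F Q e∈F λ e∈Q → none (e , e∈Q , i))
      ... | yes (e , e∈Q , i) with touched e v e∈Q i
      ...   | s , ¬g , i′ =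
        -- At `v`, compared with `F` without `M`, `F` has at most `e` in addition and `H` at least
        -- `s`. This also covers the case that `s` is `e` itself.
        ≤-trans (∑-mono-suc e others (≤-trans (ind-≤ {F} λ _ _ → ≤-refl) (s≤s z≤n)))
                (∑-mono-< (λ e′ → ind-mono {F ∖E M} {H} λ r _ → Rest⊆H e′ r) s strict)
        where
        others : ∀ e′ → e′ ≢ e → f e′ ≤ ind (F ∖E M) v e′
        others e′ e′≢e = ind-mono {F} {F ∖E M} λ e′∈F i″ →
          ∖E⁺ F M e′∈F λ e′∈M → e′≢e (matching e′ e v e′∈M (Q⊆M e e∈Q) i″ i)
        strict : ind (F ∖E M) v s < h s
        strict = subst₂ _<_ (sym (ind-zero {F ∖E M} {v} (lab-Rest s ¬g)))
                            (sym (ind⁺ {H} (live⊆H s ¬g) i′)) ≤-refl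

      h≤t+f : ∀ e → h e ≤ t e + f e
      h≤t+f e = ind-≤ {H} λ e∈H i → [ from-F i , from-T i ]′ (H⁻ e e∈H)
        where
        from-F : Incident ends v e → e ∈E (F ∖E Q) → 1 ≤ t e + f e
        from-F i e∈ = ≤-trans (≤-reflexive (sym (ind⁺ {F} (proj₁ (∖E⁻ F Q e∈)) i))) (m≤n+m _ _)
        from-T : Incident ends v e → lab e ≢ gone → 1 ≤ t e + f e
        from-T i ¬g = ≤-trans (≤-reflexive (sym (ind⁺ {T} (lab-T e ¬g) i))) (m≤m+n _ _)

      -- At an edge of Q only T can contribute to H, at an edge that v loses only F.
      strict : ∀ {e₀} → e₀ ∈E F → Incident ends v e₀ → ∃[ e ] h e < t e + f e
      strict {e₀} e₀∈F i₀ with any? (λ e → (e ∈E? Q) ×-dec incident-dec v e)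
      ... | yes (e , e∈Q , i) =
        e , subst (λ k → h e < t e + k) (sym (ind⁺ {F} (M⊆F e (Q⊆M e e∈Q)) i))
                  (subst (h e <_) (+-comm 1 (t e)) (s≤s h≤t))
        where
        h≤t : h e ≤ t e
        h≤t = ind-mono {H} {T} λ e∈H _ →
          [ (λ e∈ → contradiction e∈Q (proj₂ (∖E⁻ F Q e∈))) , lab-T e ]′ (H⁻ e e∈H)
      ... | no none with loses v e₀ e₀∈F i₀ (λ e e∈Q i → none (e , e∈Q , i))
      ...   | e , e∈T , i , g = e , subst (λ k → h e < k + f e) (sym (ind⁺ {T} e∈T i)) (s≤s h≤f)
        where
        h≤f : h e ≤ f e
        h≤f = ind-mono {H} {F} λ e∈H _ →
          [ (λ e∈ → proj₁ (∖E⁻ F Q e∈)) , (λ ¬g → contradiction g ¬g) ]′ (H⁻ e e∈H)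

      upper : ∑ h ≤ ∑ t + (∑ f ∸ 1)
      upper with any? (λ e → (e ∈E? F) ×-dec incident-dec v e)
      ... | no none = ≤-trans (∑-mono λ e → ind-mono {H} {T} (only-T e)) (m≤m+n _ _)
        where
        only-T : ∀ e → e ∈E H → Incident ends v e → e ∈E T
        only-T e e∈H i =
          [ (λ e∈ → contradiction (e , proj₁ (∖E⁻ F Q e∈) , i) none) , lab-T e ]′ (H⁻ e e∈H)
      ... | yes (e₀ , e₀∈F , i₀) with strict e₀∈F i₀
      ...   | e , h<t+f = begin
        -- The strict inequality gains one; as `∑ f` is positive, the truncated subtraction can then
        -- be moved onto `∑ f`.
        ∑ h                     ≤⟨ ∸-monoˡ-≤ 1 (∑-mono-< h≤t+f e h<t+f) ⟩
        ∑ (λ e → t e + f e) ∸ 1 ≡⟨ cong (_∸ 1) (∑-+ t f) ⟩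
        ∑ t + ∑ f ∸ 1           ≡⟨ +-∸-assoc (∑ t) 1≤∑f ⟩
        ∑ t + (∑ f ∸ 1)         ∎
        where
        open ≤-Reasoning
        1≤∑f : 1 ≤ ∑ f
        1≤∑f = ≤-trans (s≤s z≤n)
          (∑-mono-< {f = λ _ → 0} (λ _ → z≤n) e₀ (≤-reflexive (sym (ind⁺ {F} e₀∈F i₀))))

    solution : Solution
    solution = H , H-connected , Rest⊆H , λ v →
      subst₂ _≤_ (sym (degree-∑ F v)) (sym (degree-∑ H v)) (lower v) ,
      subst₂ _≤_ (sym (degree-∑ H v))
        (sym (cong₂ (λ a b → a + (b ∸ 1)) (degree-∑ T v) (degree-∑ F v))) (upper v)

  -- Each deficient end removes an edge from `Q`, so the recursion is on the size of `Q`.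
  solve : ∀ {Q} → Pending Q → Acc _<_ (size Q) → Solution
  solve {Q} P (acc rec)
    with any? (λ e → any? λ v → (e ∈E? Q) ×-dec (incident-dec v e ×-dec ¬? (touched? v)))
    where
    open Pending P
    touched? : Decidable (Touched lab)
    touched? v = any? λ t → ¬? (gone? (lab t)) ×-dec incident-dec v t
  ... | yes (e , v , e∈Q , i , ¬τ) = solve (Advance.advance P e∈Q i ¬τ) (rec (delete-size Q e∈Q))
  ... | no none = Finish.solution P λ e v e∈Q i →
    decidable-stable (any? λ t → ¬? (gone? (Pending.lab P t)) ×-dec incident-dec v t)
      λ ¬τ → none (e , v , e∈Q , i , ¬τ)

theorem4p12 : ∀ {n m} (ends : Ends n m) → Loopless ends →
    (F T M : EdgeSet m) →
    IsSpanningTree ends T →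
    IsMatching ends M →
    OneEdgePerComponent ends F M →
    (∀ e → e ∈E M →
    ¬ CutVertex ends F (proj₁ (ends e)) ⊎ ¬ CutVertex ends F (proj₂ (ends e))) →
    ∃[ H ] (Connected ends H × (F ∖E M) ⊆E H ×
    (∀ v → degree ends F v ≤ degree ends H v ×
    degree ends H v ≤ degree ends T v + (degree ends F v ∸ 1)))
theorem4p12 ends loopless F T M (T-connected , _) matching one noncut =
  solve start (<-wellFounded _)
  where open Construction ends loopless F T M T-connected matching one noncut
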